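{- Let $w,k$ be integers with $k\geq 2w+1\geq 3$, and let $G_{w,k}$ be the graph, with distinguished vertex subset $S$ of size $k$, defined in the context. Then $G_{w,k}$ has treewidth $w$, and, writing $n$ for the order of $G_{w,k}$, $$\operatorname{nc}(G_{w,k},k)=\operatorname{nc}(G_{w,k},S)=n=(k-w+1)2^w+w.$$
   Context: All graphs are finite, simple and undirected. $N[v]$ denotes the closed neighbourhood of $v$ ($v$ together with its neighbours). For a graph $G=(V,E)$ and $S\subseteq V$, $\operatorname{nc}(G,S)=|\{N[u]\cap S : u\in V\}|$ (the empty intersection is counted if it occurs), and $\operatorname{nc}(G,k)=\max_{S\subseteq V,\ |S|=k}\operatorname{nc}(G,S)$. Treewidth is the usual notion: the minimum over tree-decompositions of the maximum bag size minus $1$. Construction of $G_{w,k}$: (1) Take a set $S=\{s_1,\ldots,s_k\}$ of $k$ distinct vertices, and let $S_i=\{s_i,\ldots,s_{i+w}\}$ for $1\leq i\leq k-w$. (2) Create a set $V_1$ of $2^{w+1}-1$ new vertices: for each strict (possibly empty) subset $X\subsetneq S_1$, create a vertex $v_X\in V_1$ adjacent to exactly the vertices of $X$. (3) For each integer $i$ with $2\leq i\leq k-w$, create a set $V_i$ of $2^w-1$ new vertices: for each strict subset $X\subsetneq S_i$ with $s_{i+w}\in X$, create a vertex $v_X\in V_i$ adjacent to exactly the vertices of $X$. (4) Add edges so that, for each $1\leq i\leq k-w$, the vertices of $S_i$ form a clique. There are no other vertices or edges. -}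

module Defs where

open import Data.Bool.Properties using () renaming (_≟_ to _≟ᵇ_)
open import Data.Empty using (⊥)
open import Data.Fin using (Fin; toℕ; fromℕ<; _≟_)
open import Data.Fin.Properties using (any?; toℕ<n)
open import Data.Fin.Subset using (Subset; inside; outside; _∈_; _⊂_; _∩_; ∣_∣)
open import Data.Fin.Subset.Properties using (_∈?_; _⊂?_)
open import Data.List using (List; []; _∷_; _++_; _∷ʳ_; length; map; filter; lookup; allFin; cartesianProduct; deduplicate)
open import Data.List.Extrema.Nat using (max)
import Data.List.Membership.Propositional as List
open import Data.List.Membership.Propositional.Properties using (∈-map⁺; ∈-map⁻; ∈-++⁺ˡ; ∈-++⁺ʳ)
open import Data.List.Relation.Unary.AllPairs using ([]; _∷_)
open import Data.List.Relation.Unary.All using ([])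
open import Data.List.Relation.Unary.Any using (here)
open import Data.List.Relation.Unary.Linked using (Linked)
open import Data.List.Relation.Unary.Unique.Propositional using (Unique)
open import Data.List.Relation.Unary.Unique.Propositional.Properties using (map⁺; ++⁺; filter⁺; allFin⁺; cartesianProduct⁺)
open import Data.Nat using (ℕ; zero; suc; _+_; _∸_; _≤_; _<_; s≤s; NonZero; _≤?_)
import Data.Nat.Properties as ℕ
open import Data.Product using (Σ-syntax; ∃; ∃-syntax; _×_; _,_; proj₂; swap)
open import Data.Sum using (_⊎_; inj₁; inj₂)
open import Data.Sum.Properties using (inj₁-injective; inj₂-injective)
open import Data.Vec using ([]; _∷_; tabulate)
open import Data.Vec.Properties using (≡-dec; ∷-injectiveʳ)
open import Function using (_∘_)
open import Level using (0ℓ)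
open import Relation.Binary.Construct.Closure.ReflexiveTransitive using (Star)
open import Relation.Binary.Core using (Rel)
import Relation.Binary.Definitions as B
open import Relation.Binary.PropositionalEquality using (_≡_; _≢_; refl; sym; subst)
open import Relation.Nullary using (¬_; does; yes; no; _×-dec_; _⊎-dec_; ¬?)
open import Relation.Unary using (Pred; Decidable)

record Graph (n : ℕ) : Set₁ where
  field
    Adj    : Rel (Fin n) 0ℓ
    adj?   : B.Decidable Adj
    symm   : B.Symmetric Adj
    irrefl : ∀ {u} → ¬ Adj u u

order : ∀ {n} → Graph n → ℕ
order {n} _ = n

⟦_⟧ : ∀ {n} {P : Pred (Fin n) 0ℓ} → Decidable P → Subset n
⟦ P? ⟧ = tabulate (does ∘ P?)

allSubsets : ∀ n → List (Subset n)
allSubsets zero    = [] ∷ []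
allSubsets (suc n) = map (outside ∷_) (allSubsets n) ++ map (inside ∷_) (allSubsets n)

allSubsets-complete : ∀ {n} (X : Subset n) → X List.∈ allSubsets n
allSubsets-complete []            = here refl
allSubsets-complete (outside ∷ X) = ∈-++⁺ˡ (∈-map⁺ (outside ∷_) (allSubsets-complete X))
allSubsets-complete (inside ∷ X)  =
  ∈-++⁺ʳ (map (outside ∷_) (allSubsets _)) (∈-map⁺ (inside ∷_) (allSubsets-complete X))

allSubsets-unique : ∀ n → Unique (allSubsets n)
allSubsets-unique zero    = [] ∷ []
allSubsets-unique (suc n) =
  ++⁺ (map⁺ ∷-injectiveʳ (allSubsets-unique n))
      (map⁺ ∷-injectiveʳ (allSubsets-unique n))
      (λ (p , q) → disjoint (∈-map⁻ _ p) (∈-map⁻ _ q))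
  where
  disjoint : ∀ {Z : Subset (suc n)} →
             (∃ λ X → X List.∈ allSubsets n × Z ≡ outside ∷ X) →
             (∃ λ X → X List.∈ allSubsets n × Z ≡ inside ∷ X) → ⊥
  disjoint (_ , _ , refl) (_ , _ , ())

module _ {n} (G : Graph n) where
  open Graph G

  N[_] : Fin n → Subset n
  N[ u ] = ⟦ (λ v → (u ≟ v) ⊎-dec adj? u v) ⟧

  nc : Subset n → ℕ
  nc S = length (deduplicate (≡-dec _≟ᵇ_) (map (λ u → N[ u ] ∩ S) (allFin n)))

  -- The default value 0 is returned only if k exceeds the order of G.
  ncMax : ℕ → ℕ
  ncMax k = max 0 (map nc (filter (λ S → ∣ S ∣ ℕ.≟ k) (allSubsets n)))

  -- The subgraph induced by P is connected (or empty).
  ConnectedOn : Pred (Fin n) 0ℓ → Set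
  ConnectedOn P = ∀ {u v} → P u → P v → Star (λ a b → Adj a b × P a × P b) u v

  Connected : Set
  Connected = ∀ u v → Star Adj u v

  record Cycle : Set where
    field
      start    : Fin n
      rest     : List (Fin n)
      long     : 2 ≤ length rest
      distinct : Unique (start ∷ rest)
      closed   : Linked Adj ((start ∷ rest) ∷ʳ start)

  record IsTree : Set where
    field
      nonEmpty  : NonZero n
      connected : Connected
      acyclic   : ¬ Cycle

record TreeDecomposition {n} (G : Graph n) : Set₁ where
  field
    {size}    : ℕ
    tree      : Graph size
    isTree    : IsTree tree
    bag       : Fin size → Subset n
    vertex-in : ∀ v → ∃[ t ] v ∈ bag t
    edge-in   : ∀ {u v} → Graph.Adj G u v → ∃[ t ] u ∈ bag t × v ∈ bag t
    coherent  : ∀ v → ConnectedOn tree (λ t → v ∈ bag t)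

  -- Truncation matters only for the graph without vertices.
  width : ℕ
  width = max 0 (map (∣_∣ ∘ bag) (allFin size)) ∸ 1

IsTreewidth : ∀ {n} → Graph n → ℕ → Set₁
IsTreewidth G t =
  (Σ[ D ∈ TreeDecomposition G ] TreeDecomposition.width D ≡ t) ×
  (∀ (D : TreeDecomposition G) → t ≤ TreeDecomposition.width D)

m<n∸o⇒m+o<n : ∀ m n o → m < n ∸ o → m + o < n
m<n∸o⇒m+o<n m n       zero    lt = subst (_< n) (sym (ℕ.+-identityʳ m)) lt
m<n∸o⇒m+o<n m (suc n) (suc o) lt =
  subst (_< suc n) (sym (ℕ.+-suc m o)) (s≤s (m<n∸o⇒m+o<n m n o lt))

-- All indices are shifted to start at 0: j : Fin k stands for the vertex
-- s_{j+1} and i : Fin (k ∸ w) for the sets S_{i+1} and V_{i+1}.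
module Construction (w k : ℕ) where

  Window : Fin (k ∸ w) → Subset k
  Window i = ⟦ (λ j → (toℕ i ≤? toℕ j) ×-dec (toℕ j ≤? toℕ i + w)) ⟧

  last : Fin (k ∸ w) → Fin k
  last i = fromℕ< (m<n∸o⇒m+o<n (toℕ i) k w (toℕ<n i))

  -- inj₁ j is a vertex of S; inj₂ (i , X) is v_X in the (i+1)-st set, which is
  -- a vertex only when X is admissible.
  Label : Set
  Label = Fin k ⊎ (Fin (k ∸ w) × Subset k)

  Admissible : Pred (Fin (k ∸ w) × Subset k) 0ℓ
  Admissible (i , X) = X ⊂ Window i × (toℕ i ≡ 0 ⊎ last i ∈ X)

  admissible? : Decidable Admissible
  admissible? (i , X) = (X ⊂? Window i) ×-dec ((toℕ i ℕ.≟ 0) ⊎-dec (last i ∈? X))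

  vertices : List Label
  vertices =
    map inj₁ (allFin k) ++
    map inj₂ (filter admissible? (cartesianProduct (allFin (k ∸ w)) (allSubsets k)))

  -- Hence positions in the list correspond bijectively to vertices.
  vertices-unique : Unique vertices
  vertices-unique =
    ++⁺ (map⁺ inj₁-injective (allFin⁺ k))
        (map⁺ inj₂-injective
          (filter⁺ admissible? (cartesianProduct⁺ (allFin⁺ (k ∸ w)) (allSubsets-unique k))))
        (λ (p , q) → disjoint (∈-map⁻ inj₁ p) (∈-map⁻ inj₂ q))
    where
    disjoint : ∀ {l : Label} {xs ys} →
               (∃ λ j → j List.∈ xs × l ≡ inj₁ j) →
               (∃ λ x → x List.∈ ys × l ≡ inj₂ x) → ⊥
    disjoint (_ , _ , refl) (_ , _ , ())

  LabelAdj : Rel Label 0ℓ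
  LabelAdj (inj₁ j)       (inj₁ j′)      = j ≢ j′ × ∃[ i ] j ∈ Window i × j′ ∈ Window i
  LabelAdj (inj₁ j)       (inj₂ (_ , X)) = j ∈ X
  LabelAdj (inj₂ (_ , X)) (inj₁ j)       = j ∈ X
  LabelAdj (inj₂ _)       (inj₂ _)       = ⊥

  labelAdj? : B.Decidable LabelAdj
  labelAdj? (inj₁ j)       (inj₁ j′)      =
    ¬? (j ≟ j′) ×-dec any? (λ i → (j ∈? Window i) ×-dec (j′ ∈? Window i))
  labelAdj? (inj₁ j)       (inj₂ (_ , X)) = j ∈? X
  labelAdj? (inj₂ (_ , X)) (inj₁ j)       = j ∈? X
  labelAdj? (inj₂ _)       (inj₂ _)       = no λ ()

  labelAdj-sym : B.Symmetric LabelAdj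
  labelAdj-sym {inj₁ _} {inj₁ _} (j≢j′ , i , p) = j≢j′ ∘ sym , i , swap p
  labelAdj-sym {inj₁ _} {inj₂ _} p              = p
  labelAdj-sym {inj₂ _} {inj₁ _} p              = p

  labelAdj-irrefl : ∀ l → ¬ LabelAdj l l
  labelAdj-irrefl (inj₁ _) (j≢j , _) = j≢j refl

  label : Fin (length vertices) → Label
  label = lookup vertices

  graph : Graph (length vertices)
  graph = record
    { Adj    = λ p q → LabelAdj (label p) (label q)
    ; adj?   = λ p q → labelAdj? (label p) (label q)
    ; symm   = λ {p} {q} → labelAdj-sym {label p} {label q}
    ; irrefl = λ {p} → labelAdj-irrefl (label p)
    }

  InS : Pred Label 0ℓ
  InS l = ∃[ j ] l ≡ inj₁ j

  inS? : Decidable InS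
  inS? (inj₁ j) = yes (j , refl)
  inS? (inj₂ _) = no λ ()

  distinguished : Subset (length vertices)
  distinguished = ⟦ inS? ∘ label ⟧

G[_,_] : (w k : ℕ) → Graph (length (Construction.vertices w k))
G[_,_] = Construction.graph

S[_,_] : (w k : ℕ) → Subset (order G[ w , k ])
S[_,_] = Construction.distinguished

{-# OPTIONS --safe #-}
module Submission where

-- Traces: a vertex s_j sees in S the interval [j − w, j + w], and these intervals
-- are distinct once k ≥ 2w + 1; v_X sees X, which is strictly smaller than any
-- window and determines i, since its last element is s_(i+w) unless i = 1. So all
-- n traces on S differ, and nc never exceeds n. For n itself one counts the strict
-- subsets of each window, requiring the last element except in the first one.
--
-- Treewidth: let the vertices of G be the nodes of the tree, with s_(j−1) the
-- parent of s_j and s_i the parent of every v_X in V_i; the bags are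
-- S ∩ [s_j, s_(j+w)] and X ∪ {v_X}. Conversely a clique lies in a single bag:
-- otherwise send each node t one step towards the nodes containing a clique vertex
-- missing from its bag. Two such steps never cancel, so iterating them closes a
-- cycle in the finite tree.

open import Data.Bool using (false; true)
open import Data.Bool.Properties using () renaming (_≟_ to _≟ᵇ_)
open import Data.Empty using (⊥; ⊥-elim)
open import Data.Fin using (Fin; _≟_; fromℕ<; suc; toℕ; zero)
open import Data.Fin.Properties
  using (all?; any?; injective⇒≤; pigeonhole; suc-injective; toℕ-fromℕ<; toℕ-injective; toℕ<n; ¬∀⟶∃¬)
import Data.Fin.Subset as Subset
open import Data.Fin.Subset using (Subset; _∈_; _∉_; _∩_; _⊂_; _⊆_; inside; outside; ⁅_⁆; ∣_∣)
open import Data.Fin.Subset.Properties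
  using (_∈?_; _⊂?_; _⊆?_; drop-∷-⊆; in⊆in; out⊆; x∈p∩q⁺; x∈p∩q⁻; x∈⁅x⁆; x∈⁅y⁆⇒x≡y; ∣⁅x⁆∣≡1; ∣⊥∣≡0
    ; ⊆-antisym; ⊥⊆)
open import Data.List
  using (List; []; _++_; _∷_; _∷ʳ_; allFin; cartesianProduct; deduplicate; filter; length; lookup; map
    ; tabulate)
import Data.List.Extrema.Nat as Extrema
open import Data.List.Membership.DecPropositional using () renaming (_∈?_ to mem?)
import Data.List.Membership.Propositional as List
open import Data.List.Membership.Propositional.Properties
  using (∈-++⁺ˡ; ∈-++⁻; ∈-allFin; ∈-deduplicate⁺; ∈-deduplicate⁻; ∈-filter⁺; ∈-filter⁻; ∈-lookup; ∈-map⁺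
    ; ∈-map⁻)
open import Data.List.Properties
  using (filter-++; filter-none; filter-≐; length-++; length-map; length-tabulate)
import Data.List.Relation.Unary.All as All
open import Data.List.Relation.Unary.All using (All; []; _∷_)
import Data.List.Relation.Unary.All.Properties as All
open import Data.List.Relation.Unary.AllPairs using ([]; _∷_)
open import Data.List.Relation.Unary.Any using (here; index; there)
open import Data.List.Relation.Unary.Any.Properties using (lookup-index)
open import Data.List.Relation.Unary.Linked using (Linked; [-]; _∷_)
open import Data.List.Relation.Unary.Unique.DecPropositional.Properties using (deduplicate-!)
open import Data.List.Relation.Unary.Unique.Propositional using (Unique)
import Data.List.Relation.Unary.Unique.Propositional.Properties as Unique
import Data.Nat as ℕ
open import Data.Nat using (_*_; _+_; _<?_; _<_; _^_; _∸_; _≤?_; _≤_; suc; s≤s; zero; z≤n; ℕ)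
open import Data.Nat.GeneralisedArithmetic using (fold)
import Data.Nat.Properties as ℕ
open import Data.Nat.Solver using (module +-*-Solver)
open import Data.Product using (∃-syntax; _×_; _,_; proj₁; proj₂)
import Data.Sum as Sum
open import Data.Sum using ([_,_]′; _⊎_; inj₁; inj₂)
open import Data.Sum.Properties using (inj₁-injective)
open import Data.Unit using (tt; ⊤)
open import Data.Vec using ([]; _∷_)
open import Data.Vec.Base using (here; there)
open import Data.Vec.Properties using ([]=⇒lookup; lookup⇒[]=; lookup∘tabulate; ≡-dec)
open import Defs
open import Function using (Injective; _∘_; id)
open import Level using (0ℓ)
import Relation.Binary.Construct.Closure.ReflexiveTransitive as Star
open import Relation.Binary.Construct.Closure.ReflexiveTransitive using (Star; _◅_; _◅◅_; reverse; ε)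
open import Relation.Binary.Core using (Rel)
import Relation.Binary.Definitions as B
open import Relation.Binary.PropositionalEquality
  using (_≡_; _≢_; refl; sym; trans; cong; cong₂; subst; subst₂; module ≡-Reasoning)
open import Relation.Nullary using (_×-dec_; _⊎-dec_; does; no; yes; ¬?; ¬_)
open import Relation.Nullary.Decidable using (dec-true)
open import Relation.Unary using (Decidable; Pred)

-- Walks in trees

module _ {A : Set} (R : Rel A 0ℓ) where

  data Path : A → List A → A → Set where
    []  : ∀ {a} → Path a [] a
    _∷_ : ∀ {a b c xs} → R a b → Path b xs c → Path a (b ∷ xs) c

module _ {A : Set} {R : Rel A 0ℓ} where

  suffix : ∀ {a b c xs} → Path R a xs b → Unique (a ∷ xs) → c List.∈ (a ∷ xs) →
           ∃[ ys ] Path R c ys b × Unique (c ∷ ys)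
  suffix p        u       (here refl) = _ , p , u
  suffix (_ ∷ p)  (_ ∷ u) (there c∈)  = suffix p u c∈

  Path⇒Linked : ∀ {S : Rel A 0ℓ} {a b c xs} → (∀ {x y} → R x y → S x y) →
                Path R a xs b → S b c → Linked S (a ∷ (xs ∷ʳ c))
  Path⇒Linked _   []      s = s ∷ [-]
  Path⇒Linked R⇒S (r ∷ p) s = R⇒S r ∷ Path⇒Linked R⇒S p s

-- Loop erasure: if the first vertex recurs on the simple path found for the rest of the walk, the
-- part before that recurrence is cut off.
simplePath : ∀ {n} {R : Rel (Fin n) 0ℓ} {a b} → Star R a b →
             ∃[ xs ] Path R a xs b × Unique (a ∷ xs)
simplePath ε = [] , [] , [] ∷ []
simplePath {a = a} (_◅_ {j = c} r w) with simplePath w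
... | xs , p , u with mem? _≟_ a (c ∷ xs)
...   | yes a∈ = suffix p u a∈
...   | no a∉  = _ , r ∷ p , All.¬Any⇒All¬ _ a∉ ∷ u

module _ {n} (T : Graph n) (acyclic : ¬ Cycle T) where
  open Graph T

  -- Only the passage from `s` to `t` is forbidden, not the reverse one. For a path that starts at
  -- `s` and never returns there, this already excludes the edge.
  Except : (s t : Fin n) → Rel (Fin n) 0ℓ
  Except s t a b = Adj a b × ¬ (a ≡ s × b ≡ t)

  -- Made simple, such a walk has at least two edges, and the edge `st` closes it to a cycle.
  bridge : ∀ {s t} → Adj s t → ¬ Star (Except s t) s t
  bridge {s} st w with simplePath w
  ... | [] , [] , _ = irrefl st
  ... | _ ∷ [] , (_ , ¬st) ∷ [] , _ = ¬st (refl , refl)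
  ... | x ∷ y ∷ xs , p , u = acyclic record
    { start    = s
    ; rest     = x ∷ y ∷ xs
    ; long     = s≤s (s≤s z≤n)
    ; distinct = u
    ; closed   = Path⇒Linked proj₁ p (symm st)
    }

  Avoiding : Fin n → Rel (Fin n) 0ℓ
  Avoiding t a b = Adj a b × a ≢ t × b ≢ t

  Avoiding-sym : ∀ {t a b} → Avoiding t a b → Avoiding t b a
  Avoiding-sym (a , p , q) = symm a , q , p

  -- The step is taken where the walk leaves `t` for the last time; `go` finds that place by
  -- searching from the end.
  stepToward : ∀ {t y} → t ≢ y → Star Adj t y → ∃[ s ] Adj t s × Star (Avoiding t) s y
  stepToward {t} {y} t≢y w with go w
    where
    go : ∀ {u} → Star Adj u y → Star (Avoiding t) u y × u ≢ t ⊎ ∃[ s ] Adj t s × Star (Avoiding t) s y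
    go ε = inj₁ (ε , t≢y ∘ sym)
    go {u} (a ◅ w) with go w
    ... | inj₂ found = inj₂ found
    ... | inj₁ (w′ , v≢t) with u ≟ t
    ...   | yes refl = inj₂ (_ , a , w′)
    ...   | no u≢t   = inj₁ ((a , u≢t , v≢t) ◅ w′ , u≢t)
  ... | inj₁ (_ , t≢t) = ⊥-elim (t≢t refl)
  ... | inj₂ found     = found

  orbit : (f : Fin n → Fin n) (R : Rel (Fin n) 0ℓ) → (∀ x → R x (f x)) →
          ∀ x {i j} → i ℕ.≤′ j → Star R (fold x f i) (fold x f j)
  orbit f R r x ℕ.≤′-refl     = ε
  orbit f R r x (ℕ.≤′-step le) = orbit f R r x le ◅◅ (r _ ◅ ε)

  -- The orbit of f is a walk that never turns back, so it cannot close up.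
  noForwardMap : Fin n → (f : Fin n → Fin n) → (∀ t → Adj t (f t)) → ¬ (∀ t → f (f t) ≢ t)
  noForwardMap t₀ f adj forward
    with i , j , i<j , eq ← pigeonhole (ℕ.n<1+n n) (fold t₀ f ∘ toℕ) =
    -- Since `i < j`, the orbit from iterate `suc i` to iterate `j` is a walk from `f c` back to
    -- `c`.
    bridge (symm (adj c)) (subst (Star _ (f c)) (sym eq) (orbit f _ step t₀ (ℕ.≤⇒≤′ i<j)))
    where
    c = fold t₀ f (toℕ i)
    step : ∀ x → Except (f c) c x (f x)
    step x = adj x , λ (x≡fc , fx≡c) → forward c (trans (cong f (sym x≡fc)) fx≡c)

-- Cliques in a tree-decomposition

module _ {n} {G : Graph n} (D : TreeDecomposition G) where
  open TreeDecomposition D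
  open Graph tree
  open IsTree isTree

  clique-in-bag : ∀ {m} (c : Fin m → Fin n) →
                  (∀ {i j} → i ≢ j → Graph.Adj G (c i) (c j)) → ∃[ t ] ∀ i → c i ∈ bag t
  clique-in-bag c adjacent with any? (λ t → all? (λ i → c i ∈? bag t))
  ... | yes found = found
  ... | no none   = ⊥-elim (noForwardMap tree acyclic (nonEmpty⇒Fin nonEmpty) toward
                              (proj₁ ∘ proj₂ ∘ towardStep) forward)
    where
    nonEmpty⇒Fin : ∀ {m} → ℕ.NonZero m → Fin m
    nonEmpty⇒Fin {suc m} _ = zero

    missing : ∀ t → ∃[ i ] c i ∉ bag t
    missing t = ¬∀⟶∃¬ _ _ (λ i → c i ∈? bag t) (λ all → none (t , all))

    x : Fin size → Fin n
    x t = c (proj₁ (missing t))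

    home : Fin size → Fin size
    home t = proj₁ (vertex-in (x t))

    x∈home : ∀ t → x t ∈ bag (home t)
    x∈home t = proj₂ (vertex-in (x t))

    towardStep : ∀ t → ∃[ s ] Adj t s × Star (Avoiding tree acyclic t) s (home t)
    towardStep t = stepToward tree acyclic
      (λ eq → proj₂ (missing t) (subst (λ z → x t ∈ bag z) (sym eq) (x∈home t))) (connected t (home t))

    toward : Fin size → Fin size
    toward = proj₁ ∘ towardStep

    -- The nodes whose bags hold `x t` are connected among themselves and exclude `t`, so the step
    -- towards one of them leads to all of them.
    reach : ∀ t z → x t ∈ bag z → Star (Avoiding tree acyclic t) (toward t) z
    reach t z x∈z = proj₂ (proj₂ (towardStep t)) ◅◅ Star.map
      (λ (a , p , q) → a , avoid p , avoid q) (coherent (x t) (x∈home t) x∈z)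
      where
      avoid : ∀ {y} → x t ∈ bag y → y ≢ t
      avoid p refl = proj₂ (missing t) p

    -- Distinct clique vertices share a bag by adjacency; if both missing vertices are the same one,
    -- any bag that holds it will do.
    common : ∀ t s → ∃[ z ] x t ∈ bag z × x s ∈ bag z
    common t s with proj₁ (missing t) ≟ proj₁ (missing s)
    ... | no i≢j  = edge-in (adjacent i≢j)
    ... | yes i≡j = home t , x∈home t , subst (λ i → c i ∈ bag (home t)) i≡j (x∈home t)

    -- If the step from t to s were followed by the step from s back to t, the
    -- two missing vertices would share a bag on both sides of the edge ts.
    forward : ∀ t → toward (toward t) ≢ t
    forward t back = bridge tree acyclic (symm (proj₁ (proj₂ (towardStep t))))
      (Star.map (λ (a , _ , q) → a , q ∘ proj₂) (reach t z xt∈z) ◅◅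
       Star.map (λ (a , p , _) → a , p ∘ proj₁)
         (reverse (Avoiding-sym tree acyclic)
           (subst (λ r → Star (Avoiding tree acyclic (toward t)) r z) back (reach (toward t) z xs∈z))))
      where
      z = proj₁ (common t (toward t))
      xt∈z = proj₁ (proj₂ (common t (toward t)))
      xs∈z = proj₂ (proj₂ (common t (toward t)))

-- Cardinalities of subsets and the width

rank : ∀ {n} {p : Subset n} {x} → x ∈ p → Fin ∣ p ∣
rank {p = inside ∷ _}  here      = zero
rank {p = inside ∷ _}  (there q) = suc (rank q)
rank {p = outside ∷ _} (there q) = rank q

rank-injective : ∀ {n} {p : Subset n} {x y} (x∈p : x ∈ p) (y∈p : y ∈ p) → rank x∈p ≡ rank y∈p → x ≡ y
rank-injective {p = inside ∷ _}  here      here       _  = refl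
rank-injective {p = inside ∷ _}  (there q) (there q′) eq = cong suc (rank-injective q q′ (suc-injective eq))
rank-injective {p = outside ∷ _} (there q) (there q′) eq = cong suc (rank-injective q q′ eq)

injection⇒≤∣p∣ : ∀ {m n} {p : Subset n} (c : Fin m → Fin n) → Injective _≡_ _≡_ c → (∀ i → c i ∈ p) → m ≤ ∣ p ∣
injection⇒≤∣p∣ c inj c∈p = injective⇒≤ {f = λ i → rank (c∈p i)} (λ {i} {j} → inj ∘ rank-injective (c∈p i) (c∈p j))

element : ∀ {n} (p : Subset n) → Fin ∣ p ∣ → Fin n
element (inside ∷ p)  zero    = zero
element (inside ∷ p)  (suc i) = suc (element p i)
element (outside ∷ p) i       = suc (element p i)

element-∈ : ∀ {n} (p : Subset n) i → element p i ∈ p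
element-∈ (inside ∷ p)  zero    = here
element-∈ (inside ∷ p)  (suc i) = there (element-∈ p i)
element-∈ (outside ∷ p) i       = there (element-∈ p i)

element-injective : ∀ {n} (p : Subset n) → Injective _≡_ _≡_ (element p)
element-injective (inside ∷ p)  {zero}  {zero}  _  = refl
element-injective (inside ∷ p)  {suc i} {suc j} eq = cong suc (element-injective p (suc-injective eq))
element-injective (outside ∷ p) eq                 = element-injective p (suc-injective eq)

injection⇒∣p∣≤ : ∀ {m n} {p : Subset n} (f : Fin n → ℕ) → (∀ {u} → u ∈ p → f u < m) →
                 (∀ {u v} → u ∈ p → v ∈ p → f u ≡ f v → u ≡ v) → ∣ p ∣ ≤ m
injection⇒∣p∣≤ {p = p} f f< inj = injective⇒≤ {f = λ i → fromℕ< (f< (element-∈ p i))}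
  (λ {i} {j} eq → element-injective p (inj (element-∈ p i) (element-∈ p j)
     (trans (sym (toℕ-fromℕ< _)) (trans (cong toℕ eq) (toℕ-fromℕ< _)))))

-- Windows and bags are both bounded in this way: subtracting `a` sends the w + 1 possible values to
-- 0, ..., w.
interval-injection⇒∣p∣≤ : ∀ {n w} {p : Subset n} a (f : Fin n → ℕ) →
  (∀ {u} → u ∈ p → a ≤ f u × f u ≤ a + w) →
  (∀ {u v} → u ∈ p → v ∈ p → f u ≡ f v → u ≡ v) → ∣ p ∣ ≤ suc w
interval-injection⇒∣p∣≤ a f bounds inj = injection⇒∣p∣≤ (λ u → f u ∸ a)
  (λ u∈ → s≤s (ℕ.m≤n+o⇒m∸n≤o _ a (proj₂ (bounds u∈))))
  (λ u∈ v∈ eq → inj u∈ v∈ (ℕ.∸-cancelʳ-≡ (proj₁ (bounds u∈)) (proj₁ (bounds v∈)) eq))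

clique≤width : ∀ {n m} {G : Graph n} (c : Fin (suc m) → Fin n) → Injective _≡_ _≡_ c →
               (∀ {i j} → i ≢ j → Graph.Adj G (c i) (c j)) →
               (D : TreeDecomposition G) → m ≤ TreeDecomposition.width D
clique≤width c inj adjacent D with t , c∈ ← clique-in-bag D c adjacent =
  ℕ.∸-monoˡ-≤ 1 (ℕ.≤-trans (injection⇒≤∣p∣ c inj c∈)
    (All.lookup (Extrema.xs≤max 0 (map (∣_∣ ∘ bag) (allFin size))) (∈-map⁺ (∣_∣ ∘ bag) (∈-allFin t))))
  where open TreeDecomposition D

width≤ : ∀ {n m} {G : Graph n} (D : TreeDecomposition G) →
         (∀ t → ∣ TreeDecomposition.bag D t ∣ ≤ suc m) → TreeDecomposition.width D ≤ m
width≤ D bound = ℕ.∸-monoˡ-≤ 1 (Extrema.max≤v⁺ {xs = map (λ t → ∣ bag t ∣) (allFin size)} z≤n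
    (All.map⁺ (All.tabulate (λ {t} _ → bound t))))
  where open TreeDecomposition D

-- Rooted trees

module _ {n} (T : Graph n) (Parent : Rel (Fin n) 0ℓ) (depth : Fin n → ℕ)
         (oriented : ∀ {a b} → Graph.Adj T a b → Parent a b ⊎ Parent b a)
         (unique : ∀ {a b c} → Parent a b → Parent a c → b ≡ c)
         (descends : ∀ {a b} → Parent a b → depth b < depth a) where
  open Graph T

  ParentIn : Fin n → List (Fin n) → Set
  ParentIn a xs = ∃[ p ] p List.∈ xs × Parent a p

  parent∉⇒¬ParentIn : ∀ {a b xs} → Parent a b → All (b ≢_) xs → ¬ ParentIn a xs
  parent∉⇒¬ParentIn ab b∉ (p , p∈ , ap) = All.lookup b∉ p∈ (unique ab ap)

  -- A path that once moves away from the root keeps doing so; the two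
  -- alternatives say whether its last step moves away from the root.
  path-shape : ∀ b xs z → Linked Adj (b ∷ (xs ∷ʳ z)) → Unique (b ∷ (xs ∷ʳ z)) →
    (ParentIn z (b ∷ xs) × (depth b < depth z ⊎ ParentIn b (xs ∷ʳ z))) ⊎
    (depth z < depth b × ParentIn b (xs ∷ʳ z))
  path-shape b [] z (bz ∷ _) _ with oriented bz
  ... | inj₁ down = inj₂ (descends down , z , here refl , down)
  ... | inj₂ up   = inj₁ ((b , here refl , up) , inj₁ (descends up))
  path-shape b (c ∷ xs) z (bc ∷ l) (b∉ ∷ u) with oriented bc | path-shape c xs z l u
  ... | inj₁ down | inj₁ ((p , p∈ , zp) , _) = inj₁ ((p , there p∈ , zp) , inj₂ (c , here refl , down))
  ... | inj₁ down | inj₂ (z<c , _) = inj₂ (ℕ.<-trans z<c (descends down) , c , here refl , down)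
  ... | inj₂ up   | inj₁ ((p , p∈ , zp) , inj₁ c<z) =
    inj₁ ((p , there p∈ , zp) , inj₁ (ℕ.<-trans (descends up) c<z))
  ... | inj₂ up   | inj₁ (_ , inj₂ c↓) = ⊥-elim (parent∉⇒¬ParentIn up (All.tail b∉) c↓)
  ... | inj₂ up   | inj₂ (_ , c↓)      = ⊥-elim (parent∉⇒¬ParentIn up (All.tail b∉) c↓)

  -- The first two edges `sb` and `bc` are split off, so that `b` lies off the remaining simple path
  -- from `c` round to `s`, to which `path-shape` applies. In every combination of orientations
  -- either some vertex has two distinct parents or the depth decreases all the way round.
  acyclic-if-rooted : ¬ Cycle T
  acyclic-if-rooted record { rest = [] ; long = () }
  acyclic-if-rooted record { rest = _ ∷ [] ; long = s≤s () }
  acyclic-if-rooted record { start = s ; rest = b ∷ c ∷ ds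
                           ; distinct = s∉@(s≢b ∷ s≢c ∷ s∉ds) ∷ b∉@(b≢c ∷ b∉ds) ∷ u
                           ; closed = sb ∷ bc ∷ l }
    with oriented sb | oriented bc | path-shape c ds s l
           (Unique.++⁺ u ([] ∷ []) λ { (s∈ , here refl) → All.lookup (s≢c ∷ s∉ds) s∈ refl })
  ... | inj₁ down | _ | inj₁ (s↓ , _) = parent∉⇒¬ParentIn down b∉ s↓
  ... | inj₁ down | inj₁ down′ | inj₂ (s<c , _) =
    ℕ.<-irrefl refl (ℕ.<-trans s<c (ℕ.<-trans (descends down′) (descends down)))
  ... | _ | inj₂ up | inj₂ (_ , c↓) = parent∉⇒¬ParentIn up (All.∷ʳ⁺ b∉ds (s≢b ∘ sym)) c↓
  ... | inj₂ up | inj₁ down | _ = s≢c (unique up down)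
  ... | inj₂ up | inj₂ up′ | inj₁ (_ , inj₁ c<s) =
    ℕ.<-irrefl refl (ℕ.<-trans c<s (ℕ.<-trans (descends up) (descends up′)))
  ... | inj₂ up | inj₂ up′ | inj₁ (_ , inj₂ c↓) = parent∉⇒¬ParentIn up′ (All.∷ʳ⁺ b∉ds (s≢b ∘ sym)) c↓

-- Counting in lists and between subsets

module _ {n} {P : Pred (Fin n) 0ℓ} (P? : Decidable P) where

  ∈⟦⟧⁺ : ∀ {x} → P x → x ∈ ⟦ P? ⟧
  ∈⟦⟧⁺ {x} px = lookup⇒[]= x _ (trans (lookup∘tabulate _ x) (dec-true (P? x) px))

  ∈⟦⟧⁻ : ∀ {x} → x ∈ ⟦ P? ⟧ → P x
  ∈⟦⟧⁻ {x} x∈ with P? x | trans (sym (lookup∘tabulate (does ∘ P?) x)) ([]=⇒lookup x∈)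
  ... | yes px | _ = px

lookup-injective : ∀ {A : Set} {xs : List A} → Unique xs → Injective _≡_ _≡_ (lookup xs)
lookup-injective (_ ∷ _)  {zero}  {zero}  _  = refl
lookup-injective (x∉ ∷ _) {zero}  {suc j} eq = ⊥-elim (All.lookup x∉ (∈-lookup j) eq)
lookup-injective (x∉ ∷ _) {suc i} {zero}  eq = ⊥-elim (All.lookup x∉ (∈-lookup i) (sym eq))
lookup-injective (_ ∷ u)  {suc i} {suc j} eq = cong suc (lookup-injective u eq)

unique-⊆⇒length≤ : ∀ {A : Set} {xs ys : List A} → Unique xs → (∀ {x} → x List.∈ xs → x List.∈ ys) →
                   length xs ≤ length ys
unique-⊆⇒length≤ {xs = xs} {ys} u sub = injective⇒≤ {f = λ i → index (sub (∈-lookup i))}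
  (λ {i} {j} eq → lookup-injective u (trans (lookup-index (sub (∈-lookup i)))
     (trans (cong (lookup ys) eq) (sym (lookup-index (sub (∈-lookup j)))))))

module _ {A : Set} (_≟_ : B.DecidableEquality A) where

  length-deduplicate-≤ : ∀ xs → length (deduplicate _≟_ xs) ≤ length xs
  length-deduplicate-≤ xs = unique-⊆⇒length≤ (deduplicate-! _≟_ xs) (∈-deduplicate⁻ _≟_ xs)

  length-deduplicate-unique : ∀ {xs} → Unique xs → length (deduplicate _≟_ xs) ≡ length xs
  length-deduplicate-unique {xs} u =
    ℕ.≤-antisym (length-deduplicate-≤ xs) (unique-⊆⇒length≤ u (∈-deduplicate⁺ _≟_))

length-filter-map : ∀ {A B : Set} {P : Pred B 0ℓ} (P? : Decidable P) (f : A → B) xs →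
                    length (filter P? (map f xs)) ≡ length (filter (P? ∘ f) xs)
length-filter-map P? f []       = refl
length-filter-map P? f (x ∷ xs) with does (P? (f x))
... | true  = cong suc (length-filter-map P? f xs)
... | false = length-filter-map P? f xs

length-filter-product : ∀ {A B : Set} {P : Pred (A × B) 0ℓ} (P? : Decidable P) x xs ys →
  length (filter P? (cartesianProduct (x ∷ xs) ys)) ≡
  length (filter (P? ∘ (x ,_)) ys) + length (filter P? (cartesianProduct xs ys))
length-filter-product P? x xs ys = begin
  length (filter P? (map (x ,_) ys ++ zs))                    ≡⟨ cong length (filter-++ P? (map (x ,_) ys) zs) ⟩
  length (filter P? (map (x ,_) ys) ++ filter P? zs)          ≡⟨ length-++ (filter P? (map (x ,_) ys)) ⟩
  length (filter P? (map (x ,_) ys)) + length (filter P? zs)  ≡⟨ cong (_+ _) (length-filter-map P? (x ,_) ys) ⟩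
  length (filter (P? ∘ (x ,_)) ys) + length (filter P? zs)    ∎
  where
  open ≡-Reasoning
  zs = cartesianProduct xs ys

length-filter-product-const : ∀ {A B : Set} {P : Pred (A × B) 0ℓ} (P? : Decidable P) {c} xs ys →
  All (λ x → length (filter (P? ∘ (x ,_)) ys) ≡ c) xs →
  length (filter P? (cartesianProduct xs ys)) ≡ length xs * c
length-filter-product-const P? []       ys []       = refl
length-filter-product-const P? (x ∷ xs) ys (e ∷ es) =
  trans (length-filter-product P? x xs ys) (cong₂ _+_ e (length-filter-product-const P? xs ys es))

-- Index 0 is counted apart because V₁ is larger than the other V_i. Taking `n ≡ suc m` as an
-- equation allows `n` to be `k ∸ w`.
length-filter-allFin-product : ∀ {B : Set} {n m c d} {P : Pred (Fin n × B) 0ℓ} (P? : Decidable P) ys →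
  n ≡ suc m →
  (∀ i → toℕ i ≡ 0 → length (filter (P? ∘ (i ,_)) ys) ≡ d) →
  (∀ i → toℕ i ≢ 0 → length (filter (P? ∘ (i ,_)) ys) ≡ c) →
  length (filter P? (cartesianProduct (allFin n) ys)) ≡ d + m * c
length-filter-allFin-product {m = m} {c} P? ys refl first others = begin
  _
    ≡⟨ length-filter-product P? zero (tabulate suc) ys ⟩
  _ + length (filter P? (cartesianProduct (tabulate {n = m} suc) ys))
    ≡⟨ cong₂ _+_ (first zero refl) (length-filter-product-const P? (tabulate suc) ys
                                     (All.tabulate⁺ (λ i → others (suc i) λ ()))) ⟩
  _ + length (tabulate {n = m} suc) * c
    ≡⟨ cong (λ l → _ + l * c) (length-tabulate {n = m} suc) ⟩
  _ + m * c ∎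
  where open ≡-Reasoning

length-filter-allSubsets : ∀ {n} {P : Pred (Subset (suc n)) 0ℓ} (P? : Decidable P) →
  length (filter P? (allSubsets (suc n))) ≡
  length (filter (P? ∘ (outside ∷_)) (allSubsets n)) + length (filter (P? ∘ (inside ∷_)) (allSubsets n))
length-filter-allSubsets {n} P? = begin
  _
    ≡⟨ cong length (filter-++ P? (map (outside ∷_) (allSubsets n)) _) ⟩
  length (filter P? (map (outside ∷_) (allSubsets n)) ++ _)
    ≡⟨ length-++ (filter P? (map (outside ∷_) (allSubsets n))) ⟩
  _
    ≡⟨ cong₂ _+_ (length-filter-map P? (outside ∷_) (allSubsets n)) (length-filter-map P? (inside ∷_) (allSubsets n)) ⟩
  _ ∎
  where open ≡-Reasoning

Between StrictlyBetween : ∀ {n} (Y W : Subset n) → Pred (Subset n) 0ℓ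
Between Y W X         = Y ⊆ X × X ⊆ W
StrictlyBetween Y W X = Y ⊆ X × X ⊂ W

between-tail : ∀ {n s a t} {Y W X : Subset n} → Between (s ∷ Y) (t ∷ W) (a ∷ X) → Between Y W X
between-tail (p , q) = drop-∷-⊆ p , drop-∷-⊆ q

between? : ∀ {n} (Y W : Subset n) → Decidable (Between Y W)
between? Y W X = (Y ⊆? X) ×-dec (X ⊆? W)

strictlyBetween? : ∀ {n} (Y W : Subset n) → Decidable (StrictlyBetween Y W)
strictlyBetween? Y W X = (Y ⊆? X) ×-dec (X ⊂? W)

#between : ∀ {n} (Y W : Subset n) → ℕ
#between Y W = length (filter (between? Y W) (allSubsets _))

-- The interval has 2^(|W| - |Y|) members; multiplying out avoids the subtraction. Coordinate by
-- coordinate: one outside both sets changes nothing, one only in `W` doubles the count, and one in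
-- both doubles the power on each side.
#between-2^ : ∀ {n} (Y W : Subset n) → Y ⊆ W → #between Y W * 2 ^ ∣ Y ∣ ≡ 2 ^ ∣ W ∣
#between-2^ [] [] _ = refl
#between-2^ (inside ∷ Y) (outside ∷ W) Y⊆W with () ← Y⊆W here
#between-2^ {suc n} (outside ∷ Y) (outside ∷ W) Y⊆W = begin
  #between (outside ∷ Y) (outside ∷ W) * 2 ^ ∣ Y ∣
    ≡⟨ cong (_* 2 ^ ∣ Y ∣) (trans (length-filter-allSubsets (between? (outside ∷ Y) (outside ∷ W))) (cong₂ _+_
         (cong length (filter-≐ _ (between? Y W) (between-tail , (λ (p , q) → out⊆ p , out⊆ q)) (allSubsets n)))
         (cong length (filter-none _ (All.universal (λ { X (_ , q) → case-in q }) (allSubsets n)))))) ⟩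
  (#between Y W + 0) * 2 ^ ∣ Y ∣  ≡⟨ cong (_* 2 ^ ∣ Y ∣) (ℕ.+-identityʳ (#between Y W)) ⟩
  #between Y W * 2 ^ ∣ Y ∣        ≡⟨ #between-2^ Y W (drop-∷-⊆ Y⊆W) ⟩
  2 ^ ∣ W ∣                       ∎
  where
  open ≡-Reasoning
  case-in : ∀ {X} → ¬ (inside ∷ X ⊆ outside ∷ W)
  case-in q with () ← q here
#between-2^ {suc n} (outside ∷ Y) (inside ∷ W) Y⊆W = begin
  #between (outside ∷ Y) (inside ∷ W) * 2 ^ ∣ Y ∣
    ≡⟨ cong (_* 2 ^ ∣ Y ∣) (trans (length-filter-allSubsets (between? (outside ∷ Y) (inside ∷ W))) (cong₂ _+_
         (cong length (filter-≐ _ (between? Y W) (between-tail , (λ (p , q) → out⊆ p , out⊆ q)) (allSubsets n)))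
         (cong length (filter-≐ _ (between? Y W) (between-tail , (λ (p , q) → out⊆ p , in⊆in q)) (allSubsets n))))) ⟩
  (#between Y W + #between Y W) * 2 ^ ∣ Y ∣
    ≡⟨ solve 2 (λ c y → (c :+ c) :* y := con 2 :* (c :* y)) refl (#between Y W) (2 ^ ∣ Y ∣) ⟩
  2 * (#between Y W * 2 ^ ∣ Y ∣)             ≡⟨ cong (2 *_) (#between-2^ Y W (drop-∷-⊆ Y⊆W)) ⟩
  2 * 2 ^ ∣ W ∣                              ∎
  where
  open ≡-Reasoning
  open +-*-Solver
#between-2^ {suc n} (inside ∷ Y) (inside ∷ W) Y⊆W = begin
  #between (inside ∷ Y) (inside ∷ W) * (2 * 2 ^ ∣ Y ∣)
    ≡⟨ cong (_* (2 * 2 ^ ∣ Y ∣)) (trans (length-filter-allSubsets (between? (inside ∷ Y) (inside ∷ W))) (cong₂ _+_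
         (cong length (filter-none _ (All.universal (λ { X (p , _) → case-out p }) (allSubsets n))))
         (cong length (filter-≐ _ (between? Y W) (between-tail , (λ (p , q) → in⊆in p , in⊆in q)) (allSubsets n))))) ⟩
  #between Y W * (2 * 2 ^ ∣ Y ∣)
    ≡⟨ solve 2 (λ c y → c :* (con 2 :* y) := con 2 :* (c :* y)) refl (#between Y W) (2 ^ ∣ Y ∣) ⟩
  2 * (#between Y W * 2 ^ ∣ Y ∣)  ≡⟨ cong (2 *_) (#between-2^ Y W (drop-∷-⊆ Y⊆W)) ⟩
  2 * 2 ^ ∣ W ∣                   ∎
  where
  open ≡-Reasoning
  open +-*-Solver
  case-out : ∀ {X} → ¬ (inside ∷ Y ⊆ outside ∷ X)
  case-out q with () ← q here

⊆⇒≡⊎⊂ : ∀ {n} {X W : Subset n} → X ⊆ W → X ≡ W ⊎ X ⊂ W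
⊆⇒≡⊎⊂ {X = X} {W} X⊆W with any? (λ x → (x ∈? W) ×-dec ¬? (x ∈? X))
... | yes (x , x∈W , x∉X) = inj₂ (X⊆W , x , x∈W , x∉X)
... | no none = inj₁ (⊆-antisym X⊆W W⊆X)
  where
  W⊆X : W ⊆ X
  W⊆X {x} x∈W with x ∈? X
  ... | yes x∈X = x∈X
  ... | no x∉X  = ⊥-elim (none (x , x∈W , x∉X))

-- Strictness removes exactly `W` itself, which lies in the interval because `Y ⊆ W`.
#strictlyBetween : ∀ {n} (Y W : Subset n) → Y ⊆ W →
  suc (length (filter (strictlyBetween? Y W) (allSubsets n))) ≡ #between Y W
#strictlyBetween {n} Y W Y⊆W = ℕ.≤-antisym
  (unique-⊆⇒length≤ (All.tabulate W≢ ∷ Unique.filter⁺ (strictlyBetween? Y W) (allSubsets-unique n)) sub)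
  (unique-⊆⇒length≤ (Unique.filter⁺ (between? Y W) (allSubsets-unique n)) sup)
  where
  strict = filter (strictlyBetween? Y W) (allSubsets n)
  W≢ : ∀ {X} → X List.∈ strict → W ≢ X
  W≢ X∈ refl with _ , _ , _ , _ , x∈ , x∉ ← ∈-filter⁻ (strictlyBetween? Y W) {xs = allSubsets n} X∈ = x∉ x∈
  sub : ∀ {X} → X List.∈ (W ∷ strict) → X List.∈ filter (between? Y W) (allSubsets n)
  sub (here refl) = ∈-filter⁺ (between? Y W) (allSubsets-complete _) (Y⊆W , id)
  sub (there X∈) with _ , p , q , _ ← ∈-filter⁻ (strictlyBetween? Y W) {xs = allSubsets n} X∈ =
    ∈-filter⁺ (between? Y W) (allSubsets-complete _) (p , q)
  sup : ∀ {X} → X List.∈ filter (between? Y W) (allSubsets n) → X List.∈ (W ∷ strict)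
  sup X∈ with _ , p , q ← ∈-filter⁻ (between? Y W) {xs = allSubsets n} X∈ with ⊆⇒≡⊎⊂ q
  ... | inj₁ refl = here refl
  ... | inj₂ X⊂W  = there (∈-filter⁺ (strictlyBetween? Y W) (allSubsets-complete _) (p , X⊂W))

-- Neighbourhood complexity in an arbitrary graph

module _ {n} (G : Graph n) where

  length-nbhds : ∀ S → length (map (λ u → N[_] G u ∩ S) (allFin n)) ≡ n
  length-nbhds S = trans (length-map _ (allFin n)) (length-tabulate {n = n} id)

  nc≤order : ∀ S → nc G S ≤ n
  nc≤order S = subst (nc G S ≤_) (length-nbhds S)
    (length-deduplicate-≤ (≡-dec _≟ᵇ_) (map (λ u → N[_] G u ∩ S) (allFin n)))

  nc-injective : ∀ S → (∀ {u v} → N[_] G u ∩ S ≡ N[_] G v ∩ S → u ≡ v) → nc G S ≡ n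
  nc-injective S inj = trans
    (length-deduplicate-unique (≡-dec _≟ᵇ_) (Unique.map⁺ inj (Unique.allFin⁺ n))) (length-nbhds S)

  -- No set has more traces than there are vertices, so a set of size `k` that reaches this bound is
  -- a maximiser.
  nc≡order⇒ncMax≡nc : ∀ {k} S → nc G S ≡ n → ∣ S ∣ ≡ k → ncMax G k ≡ nc G S
  nc≡order⇒ncMax≡nc {k} S nc≡n ∣S∣≡k = ℕ.≤-antisym
    (Extrema.max≤v⁺ {xs = map (nc G) k-subsets} z≤n
      (All.map⁺ (All.tabulate (λ {S′} _ → subst (nc G S′ ≤_) (sym nc≡n) (nc≤order S′)))))
    (All.lookup (Extrema.xs≤max 0 (map (nc G) k-subsets))
      (∈-map⁺ (nc G) (∈-filter⁺ (λ S → ∣ S ∣ ℕ.≟ k) (allSubsets-complete S) ∣S∣≡k)))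
    where k-subsets = filter (λ S → ∣ S ∣ ℕ.≟ k) (allSubsets n)

-- M + 1 is the number of windows, and k ≥ 2w + 1 amounts to w ≤ M.
module _ (w k M : ℕ) (k≡ : k ≡ suc M + w) where
  open Construction w k

  -- Vertices, labels and windows

  k∸w≡ : k ∸ w ≡ suc M
  k∸w≡ = trans (cong (_∸ w) k≡) (ℕ.m+n∸n≡m (suc M) w)

  V : Set
  V = Fin (length vertices)

  vertex : Fin k → V
  vertex j = index (∈-++⁺ˡ {ys = map inj₂ (filter admissible? (cartesianProduct (allFin (k ∸ w)) (allSubsets k)))}
                           (∈-map⁺ inj₁ (∈-allFin j)))

  label-vertex : ∀ j → label (vertex j) ≡ inj₁ j
  label-vertex j = sym (lookup-index (∈-++⁺ˡ (∈-map⁺ inj₁ (∈-allFin j))))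

  label-injective : ∀ {u v} → label u ≡ label v → u ≡ v
  label-injective = lookup-injective vertices-unique

  label≡inj₁ : ∀ {u j} → label u ≡ inj₁ j → u ≡ vertex j
  label≡inj₁ eq = label-injective (trans eq (sym (label-vertex _)))

  vertex-injective : ∀ {j j′} → vertex j ≡ vertex j′ → j ≡ j′
  vertex-injective eq = inj₁-injective (trans (sym (label-vertex _)) (trans (cong label eq) (label-vertex _)))

  admissible : ∀ u {y} → label u ≡ inj₂ y → Admissible y
  admissible u eq with ∈-++⁻ (map inj₁ (allFin k)) (∈-lookup u)
  ... | inj₁ l∈ with _ , _ , eq′ ← ∈-map⁻ inj₁ l∈ with () ← trans (sym eq) eq′
  ... | inj₂ l∈ with y , y∈ , eq′ ← ∈-map⁻ inj₂ l∈ with refl ← trans (sym eq) eq′ =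
    proj₂ (∈-filter⁻ admissible? {xs = cartesianProduct (allFin (k ∸ w)) (allSubsets k)} y∈)

  ∈Window⁺ : ∀ {i j} → toℕ i ≤ toℕ j → toℕ j ≤ toℕ i + w → j ∈ Window i
  ∈Window⁺ {i} p q = ∈⟦⟧⁺ (λ j → (toℕ i ≤? toℕ j) ×-dec (toℕ j ≤? toℕ i + w)) (p , q)

  ∈Window⁻ : ∀ {i j} → j ∈ Window i → toℕ i ≤ toℕ j × toℕ j ≤ toℕ i + w
  ∈Window⁻ {i} = ∈⟦⟧⁻ (λ j → (toℕ i ≤? toℕ j) ×-dec (toℕ j ≤? toℕ i + w))

  toℕ-last : ∀ i → toℕ (last i) ≡ toℕ i + w
  toℕ-last i = toℕ-fromℕ< _

  last∈Window : ∀ i → last i ∈ Window i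
  last∈Window i = ∈Window⁺ (subst (toℕ i ≤_) (sym (toℕ-last i)) (ℕ.m≤m+n _ w)) (ℕ.≤-reflexive (toℕ-last i))

  ∣Window∣≡ : ∀ i → ∣ Window i ∣ ≡ suc w
  ∣Window∣≡ i = ℕ.≤-antisym
    (interval-injection⇒∣p∣≤ (toℕ i) toℕ (∈Window⁻ {i}) (λ _ _ → toℕ-injective))
    (injection⇒≤∣p∣ place place-injective (λ t → ∈Window⁺ {i}
      (subst (toℕ i ≤_) (sym (toℕ-place t)) (ℕ.m≤m+n _ _))
      (subst (_≤ toℕ i + w) (sym (toℕ-place t)) (ℕ.+-monoʳ-≤ (toℕ i) (ℕ.s≤s⁻¹ (toℕ<n t))))))
    where
    place< : ∀ (t : Fin (suc w)) → toℕ i + toℕ t < k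
    place< t = ℕ.≤-<-trans (ℕ.+-monoʳ-≤ (toℕ i) (ℕ.s≤s⁻¹ (toℕ<n t))) (m<n∸o⇒m+o<n (toℕ i) k w (toℕ<n i))
    place : Fin (suc w) → Fin k
    place t = fromℕ< (place< t)
    toℕ-place : ∀ t → toℕ (place t) ≡ toℕ i + toℕ t
    toℕ-place t = toℕ-fromℕ< _
    place-injective : ∀ {t t′} → place t ≡ place t′ → t ≡ t′
    place-injective {t} {t′} eq = toℕ-injective (ℕ.+-cancelˡ-≡ (toℕ i) _ _
      (trans (sym (toℕ-place t)) (trans (cong toℕ eq) (toℕ-place t′))))

  -- The window that starts at `j` serves if there is one. Otherwise `j` exceeds `M`, and the last
  -- window, from M to M + w = k - 1, contains both.
  common-window : ∀ {j l : Fin k} → toℕ j ≤ toℕ l → toℕ l ≤ toℕ j + w → ∃[ i ] j ∈ Window i × l ∈ Window i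
  common-window {j} {l} j≤l l≤j+w with toℕ j <? suc M
  ... | yes j≤M = i , ∈Window⁺ (ℕ.≤-reflexive i≡j) (subst (λ x → toℕ j ≤ x + w) (sym i≡j) (ℕ.m≤m+n _ w))
                    , ∈Window⁺ (subst (_≤ toℕ l) (sym i≡j) j≤l) (subst (λ x → toℕ l ≤ x + w) (sym i≡j) l≤j+w)
    where
    i = fromℕ< (subst (toℕ j <_) (sym k∸w≡) j≤M)
    i≡j : toℕ i ≡ toℕ j
    i≡j = toℕ-fromℕ< _
  ... | no j≰M = i , ∈Window⁺ (ℕ.≤-trans i≤M M≤j) (below j) , ∈Window⁺ (ℕ.≤-trans i≤M (ℕ.≤-trans M≤j j≤l)) (below l)
    where
    i = fromℕ< (subst (M <_) (sym k∸w≡) (ℕ.n<1+n M))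
    i≡M : toℕ i ≡ M
    i≡M = toℕ-fromℕ< _
    i≤M = ℕ.≤-reflexive i≡M
    M≤j : M ≤ toℕ j
    M≤j = ℕ.<⇒≤ (ℕ.≮⇒≥ j≰M)
    below : ∀ (x : Fin k) → toℕ x ≤ toℕ i + w
    below x = subst (λ y → toℕ x ≤ y + w) (sym i≡M) (ℕ.s≤s⁻¹ (subst (toℕ x <_) k≡ (toℕ<n x)))

  -- This is |j - l| ≤ w, written without truncated subtraction.
  Near : Rel (Fin k) 0ℓ
  Near j l = toℕ l ≤ toℕ j + w × toℕ j ≤ toℕ l + w

  window⇒near : ∀ i {j l} → j ∈ Window i → l ∈ Window i → Near j l
  window⇒near i j∈ l∈ with i≤j , j≤ ← ∈Window⁻ {i} j∈ | i≤l , l≤ ← ∈Window⁻ {i} l∈ =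
    ℕ.≤-trans l≤ (ℕ.+-monoˡ-≤ w i≤j) , ℕ.≤-trans j≤ (ℕ.+-monoˡ-≤ w i≤l)

  -- Together with `window⇒near` this turns adjacency inside S into a condition on distances alone.
  near⇒window : ∀ {j l} → Near j l → ∃[ i ] j ∈ Window i × l ∈ Window i
  near⇒window {j} {l} (l≤ , j≤) with ℕ.≤-total (toℕ j) (toℕ l)
  ... | inj₁ j≤l = common-window j≤l l≤
  ... | inj₂ l≤j with i , p , q ← common-window l≤j j≤ = i , q , p

  -- The order of the graph

  order-formula : length vertices ≡ (k ∸ w + 1) * 2 ^ w + w
  order-formula = begin
    length vertices
      ≡⟨ length-++ (map inj₁ (allFin k)) ⟩
    length (map {B = Label} inj₁ (allFin k)) + length (map {B = Label} inj₂ candidates)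
      ≡⟨ cong₂ _+_ (trans (length-map inj₁ (allFin k)) (length-tabulate {n = k} id)) (length-map inj₂ candidates) ⟩
    k + length candidates
      ≡⟨ cong (k +_) (length-filter-allFin-product admissible? (allSubsets k) k∸w≡ first others) ⟩
    k + (c + suc c + M * c)
      ≡⟨ cong (_+ (c + suc c + M * c)) k≡ ⟩
    suc M + w + (c + suc c + M * c)
      ≡⟨ solve 3 (λ M w c → con 1 :+ M :+ w :+ (c :+ (con 1 :+ c) :+ M :* c)
                         := (con 1 :+ M :+ con 1) :* (con 1 :+ c) :+ w) refl M w c ⟩
    (suc M + 1) * suc c + w
      ≡⟨ cong₂ (λ m p → (m + 1) * p + w) (sym k∸w≡) sc≡ ⟩
    (k ∸ w + 1) * 2 ^ w + w ∎
    where
    open ≡-Reasoning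
    open +-*-Solver
    candidates = filter admissible? (cartesianProduct (allFin (k ∸ w)) (allSubsets k))
    -- Each V_i other than V₁ has c = 2^w - 1 vertices, and V₁ has 2^(w+1) - 1 = c + (c + 1).
    c = ℕ.pred (2 ^ w)
    sc≡ : suc c ≡ 2 ^ w
    sc≡ = ℕ.suc-pred (2 ^ w) ⦃ ℕ.m^n≢0 2 w ⦄

    -- `Y` collects the elements that admissibility forces into X: none for index 0, and `last i`
    -- for every other index.
    count : ∀ i Y → Y ⊆ Window i → (∀ {X} → Admissible (i , X) → Y ⊆ X) →
            (∀ {X} → Y ⊆ X → X ⊂ Window i → Admissible (i , X)) →
            suc (length (filter (λ X → admissible? (i , X)) (allSubsets k))) * 2 ^ ∣ Y ∣ ≡ 2 ^ suc w
    count i Y Y⊆W to from = begin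
      suc (length (filter (λ X → admissible? (i , X)) (allSubsets k))) * 2 ^ ∣ Y ∣
        ≡⟨ cong (λ xs → suc (length xs) * 2 ^ ∣ Y ∣)
             (filter-≐ _ (strictlyBetween? Y (Window i)) ((λ a → to a , proj₁ a) , λ (p , q) → from p q) (allSubsets k)) ⟩
      suc (length (filter (strictlyBetween? Y (Window i)) (allSubsets k))) * 2 ^ ∣ Y ∣
        ≡⟨ cong (_* 2 ^ ∣ Y ∣) (#strictlyBetween Y (Window i) Y⊆W) ⟩
      #between Y (Window i) * 2 ^ ∣ Y ∣
        ≡⟨ #between-2^ Y (Window i) Y⊆W ⟩
      2 ^ ∣ Window i ∣
        ≡⟨ cong (2 ^_) (∣Window∣≡ i) ⟩
      2 ^ suc w ∎

    first : ∀ i → toℕ i ≡ 0 →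
            length (filter (λ X → admissible? (i , X)) (allSubsets k)) ≡ c + suc c
    first i i≡0 = ℕ.suc-injective (begin
      suc #i                         ≡⟨ sym (ℕ.*-identityʳ _) ⟩
      suc #i * 2 ^ 0                 ≡⟨ cong (λ e → suc #i * 2 ^ e) (sym (∣⊥∣≡0 k)) ⟩
      suc #i * 2 ^ ∣ Subset.⊥ {k} ∣  ≡⟨ count i Subset.⊥ ⊥⊆ (λ _ → ⊥⊆) (λ _ X⊂W → X⊂W , inj₁ i≡0) ⟩
      2 * 2 ^ w                      ≡⟨ cong (2 *_) (sym sc≡) ⟩
      2 * suc c                      ≡⟨ cong (suc c +_) (ℕ.+-identityʳ (suc c)) ⟩
      suc c + suc c                  ∎)
      where #i = length (filter (λ X → admissible? (i , X)) (allSubsets k))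

    others : ∀ i → toℕ i ≢ 0 →
             length (filter (λ X → admissible? (i , X)) (allSubsets k)) ≡ c
    -- The factor 2 to be cancelled is 2^|Y| for the singleton of the forced last element.
    others i i≢0 = ℕ.suc-injective (ℕ.*-cancelʳ-≡ (suc #i) (suc c) 2 (begin
      suc #i * 2                   ≡⟨ cong (λ e → suc #i * 2 ^ e) (sym (∣⁅x⁆∣≡1 (last i))) ⟩
      suc #i * 2 ^ ∣ ⁅ last i ⁆ ∣  ≡⟨ count i ⁅ last i ⁆ ⊆W to (λ l⊆X X⊂W → X⊂W , inj₂ (l⊆X (x∈⁅x⁆ (last i)))) ⟩
      2 * 2 ^ w                    ≡⟨ cong (2 *_) (sym sc≡) ⟩
      2 * suc c                    ≡⟨ ℕ.*-comm 2 (suc c) ⟩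
      suc c * 2                    ∎))
      where
      #i = length (filter (λ X → admissible? (i , X)) (allSubsets k))
      ⊆W : ⁅ last i ⁆ ⊆ Window i
      ⊆W x∈ with refl ← x∈⁅y⁆⇒x≡y (last i) x∈ = last∈Window i
      to : ∀ {X} → Admissible (i , X) → ⁅ last i ⁆ ⊆ X
      to (_ , inj₁ i≡0) _ = ⊥-elim (i≢0 i≡0)
      to (_ , inj₂ l∈X) x∈ with refl ← x∈⁅y⁆⇒x≡y (last i) x∈ = l∈X

  -- Traces on the distinguished set

  Trace : Label → Fin k → Set
  Trace l j = l ≡ inj₁ j ⊎ LabelAdj l (inj₁ j)

  near⇒trace : ∀ {j l} → Near j l → Trace (inj₁ j) l
  near⇒trace {j} {l} near with j ≟ l
  ... | yes refl = inj₁ refl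
  ... | no j≢l   = inj₂ (j≢l , near⇒window near)

  trace⇒near : ∀ {j l} → Trace (inj₁ j) l → Near j l
  trace⇒near (inj₁ refl)             = ℕ.m≤m+n _ w , ℕ.m≤m+n _ w
  trace⇒near (inj₂ (_ , i , j∈ , l∈)) = window⇒near i j∈ l∈

  _⊑_ : Label → Label → Set
  l ⊑ l′ = ∀ j → Trace l j → Trace l′ j

  -- For j < j′ the separating element is j′ + w, or j′ − w − 1 if that is too large.
  near-separated : w ≤ M → ∀ {j j′} → toℕ j < toℕ j′ → inj₁ j ⊑ inj₁ j′ → ¬ (inj₁ j′ ⊑ inj₁ j)
  near-separated w≤M {j} {j′} j<j′ sub sup with toℕ j′ + w <? k
  ... | yes j′+w<k = ℕ.<⇒≱ j<j′ (ℕ.+-cancelʳ-≤ w _ _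
    (subst (_≤ toℕ j + w) l≡ (proj₁ (trace⇒near (sup l (near⇒trace (ℕ.≤-reflexive l≡ , j′≤l+w)))))))
    where
    l = fromℕ< j′+w<k
    l≡ : toℕ l ≡ toℕ j′ + w
    l≡ = toℕ-fromℕ< _
    j′≤l+w : toℕ j′ ≤ toℕ l + w
    j′≤l+w = subst (λ x → toℕ j′ ≤ x + w) (sym l≡) (ℕ.≤-trans (ℕ.m≤m+n _ w) (ℕ.m≤m+n _ w))
  ... | no j′+w≮k = ℕ.<⇒≱ l+w<j′ (proj₂ (trace⇒near (sub l (near⇒trace (l≤j+w , j≤l+w)))))
    where
    -- Here k ≥ 2w + 1 enters: j′ + w ≥ k = M + 1 + w and w ≤ M give j′ ≥ w + 1, so that j′ - w - 1
    -- is an index.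
    w<j′ : suc w ≤ toℕ j′
    w<j′ = ℕ.+-cancelʳ-≤ w _ _
      (ℕ.≤-trans (ℕ.+-monoˡ-≤ w (s≤s w≤M)) (subst (_≤ toℕ j′ + w) k≡ (ℕ.≮⇒≥ j′+w≮k)))
    l = fromℕ< (ℕ.≤-<-trans (ℕ.m∸n≤m (toℕ j′) (suc w)) (toℕ<n j′))
    l≡ : toℕ l ≡ toℕ j′ ∸ suc w
    l≡ = toℕ-fromℕ< _
    l+w≡ : suc (toℕ l + w) ≡ toℕ j′
    l+w≡ = trans (sym (ℕ.+-suc (toℕ l) w)) (trans (cong (_+ suc w) l≡) (ℕ.m∸n+n≡m w<j′))
    l+w<j′ : toℕ l + w < toℕ j′
    l+w<j′ = ℕ.≤-reflexive l+w≡
    j′≤j+w : toℕ j′ ≤ toℕ j + w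
    j′≤j+w = proj₂ (trace⇒near (sub j (inj₁ refl)))
    l≤j+w : toℕ l ≤ toℕ j + w
    l≤j+w = ℕ.≤-trans (ℕ.m≤m+n _ w) (ℕ.≤-trans (ℕ.<⇒≤ l+w<j′) j′≤j+w)
    j≤l+w : toℕ j ≤ toℕ l + w
    j≤l+w = ℕ.s≤s⁻¹ (subst (toℕ j <_) (sym l+w≡) j<j′)

  -- The trace of s_j contains j, so j would lie in X and hence in the window. Then the whole window
  -- is near j and would be contained in X, which misses one of its elements.
  ⊂Window⇒⋢ : ∀ j i {X} → X ⊂ Window i → inj₁ j ⊑ inj₂ (i , X) → ¬ (inj₂ (i , X) ⊑ inj₁ j)
  ⊂Window⇒⋢ j i (X⊆W , x , x∈W , x∉X) sub sup with sub j (inj₁ refl)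
  ... | inj₂ j∈X with sub x (near⇒trace (window⇒near i (X⊆W j∈X) x∈W))
  ...   | inj₂ x∈X = x∉X x∈X

  -- Unless i′ is 0, X contains the index i′ + w, while no element of `Window i` exceeds i + w.
  index-≤ : ∀ {i i′ X} → Admissible (i , X) → Admissible (i′ , X) → toℕ i′ ≤ toℕ i
  index-≤ {i} {i′} (X⊆W , _) (_ , inj₁ i′≡0) = subst (_≤ toℕ i) (sym i′≡0) z≤n
  index-≤ {i} {i′} ((X⊆W , _) , _) (_ , inj₂ last∈X) =
    ℕ.+-cancelʳ-≤ w _ _ (subst (_≤ toℕ i + w) (toℕ-last i′) (proj₂ (∈Window⁻ {i} (X⊆W last∈X))))

  -- This concerns vertices rather than arbitrary labels, since admissibility comes from membership
  -- in `vertices`. The trace of v_X returns X, and X returns i by `index-≤` applied both ways.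
  trace-determines-label : w ≤ M → ∀ u v → label u ⊑ label v → label v ⊑ label u → label u ≡ label v
  trace-determines-label w≤M u v sub sup with label u in eq | label v in eq′
  ... | inj₁ j | inj₁ j′ with ℕ.<-cmp (toℕ j) (toℕ j′)
  ...   | B.tri< j<j′ _ _ = ⊥-elim (near-separated w≤M j<j′ sub sup)
  ...   | B.tri≈ _ j≡j′ _ = cong inj₁ (toℕ-injective j≡j′)
  ...   | B.tri> _ _ j′<j = ⊥-elim (near-separated w≤M j′<j sup sub)
  trace-determines-label w≤M u v sub sup | inj₁ j | inj₂ (i , X) =
    ⊥-elim (⊂Window⇒⋢ j i (proj₁ (admissible v eq′)) sub sup)
  trace-determines-label w≤M u v sub sup | inj₂ (i , X) | inj₁ j =
    ⊥-elim (⊂Window⇒⋢ j i (proj₁ (admissible u eq)) sup sub)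
  trace-determines-label w≤M u v sub sup | inj₂ (i , X) | inj₂ (i′ , X′) =
    cong inj₂ (cong₂ _,_ (toℕ-injective (ℕ.≤-antisym
      (index-≤ (admissible v eq′) (subst (λ Z → Admissible (i , Z)) X≡X′ (admissible u eq)))
      (index-≤ (subst (λ Z → Admissible (i , Z)) X≡X′ (admissible u eq)) (admissible v eq′)))) X≡X′)
    where
    member : ∀ {i X x} → Trace (inj₂ (i , X)) x → x ∈ X
    member (inj₂ x∈) = x∈
    X≡X′ : X ≡ X′
    X≡X′ = ⊆-antisym (λ {x} x∈ → member (sub x (inj₂ x∈))) (λ {x} x∈ → member (sup x (inj₂ x∈)))

  -- Agrees by computation with the decision procedure inside `N[_]`, so that membership in `⟦_⟧`
  -- carries over.
  neighbourhood? : ∀ u → Decidable (λ v → u ≡ v ⊎ LabelAdj (label u) (label v))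
  neighbourhood? u v = (u ≟ v) ⊎-dec labelAdj? (label u) (label v)

  trace-of : V → Subset (length vertices)
  trace-of u = N[_] graph u ∩ distinguished

  vertex∈distinguished : ∀ j → vertex j ∈ distinguished
  vertex∈distinguished j = ∈⟦⟧⁺ (inS? ∘ label) (j , label-vertex j)

  vertex∈trace⁺ : ∀ {u j} → Trace (label u) j → vertex j ∈ trace-of u
  vertex∈trace⁺ {u} {j} t = x∈p∩q⁺ (∈⟦⟧⁺ (neighbourhood? u) (adjacent t) , vertex∈distinguished j)
    where
    adjacent : Trace (label u) j → u ≡ vertex j ⊎ LabelAdj (label u) (label (vertex j))
    adjacent (inj₁ eq) = inj₁ (label≡inj₁ eq)
    adjacent (inj₂ a)  = inj₂ (subst (LabelAdj (label u)) (sym (label-vertex j)) a)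

  vertex∈trace⁻ : ∀ {u j} → vertex j ∈ trace-of u → Trace (label u) j
  vertex∈trace⁻ {u} {j} x∈ with ∈⟦⟧⁻ (neighbourhood? u) (proj₁ (x∈p∩q⁻ (N[_] graph u) distinguished x∈))
  ... | inj₁ refl = inj₁ (label-vertex j)
  ... | inj₂ a    = inj₂ (subst (LabelAdj (label u)) (label-vertex j) a)

  trace-injective : w ≤ M → ∀ {u v} → trace-of u ≡ trace-of v → u ≡ v
  trace-injective w≤M {u} {v} eq = label-injective (trace-determines-label w≤M u v
    (λ j t → vertex∈trace⁻ (subst (vertex j ∈_) eq (vertex∈trace⁺ t)))
    (λ j t → vertex∈trace⁻ (subst (vertex j ∈_) (sym eq) (vertex∈trace⁺ t))))

  nc-distinguished : w ≤ M → nc graph distinguished ≡ length vertices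
  nc-distinguished w≤M = nc-injective graph distinguished (trace-injective w≤M)

  -- The default `d` is 0 for sets without any v_X; for the bag of v_X it is chosen so that v_X gets
  -- a place not taken by X.
  position : ℕ → Label → ℕ
  position d (inj₁ j) = toℕ j
  position d (inj₂ _) = d

  equal-positions : ∀ {d u v j j′} → label u ≡ inj₁ j → label v ≡ inj₁ j′ →
                    position d (label u) ≡ position d (label v) → u ≡ v
  equal-positions {d} u≡ v≡ eq = label-injective (trans u≡ (trans (cong inj₁ (toℕ-injective
    (trans (sym (cong (position d) u≡)) (trans eq (cong (position d) v≡))))) (sym v≡)))

  ∣distinguished∣≡ : ∣ distinguished ∣ ≡ k
  ∣distinguished∣≡ = ℕ.≤-antisym
    (injection⇒∣p∣≤ (position 0 ∘ label) (λ {u} → position<k u)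
      (λ u∈ v∈ → equal-positions (proj₂ (inS u∈)) (proj₂ (inS v∈))))
    (injection⇒≤∣p∣ vertex vertex-injective vertex∈distinguished)
    where
    inS : ∀ {u} → u ∈ distinguished → InS (label u)
    inS = ∈⟦⟧⁻ (inS? ∘ label)
    position<k : ∀ u → u ∈ distinguished → position 0 (label u) < k
    position<k u u∈ with label u | inS u∈
    ... | _ | j , refl = toℕ<n j

  -- Treewidth: the lower bound

  clique-width : ∀ (D : TreeDecomposition graph) → w ≤ TreeDecomposition.width D
  clique-width = clique≤width (vertex ∘ place) (λ eq → place-injective (vertex-injective eq)) adjacent
    where
    w<k : suc w ≤ k
    w<k = subst (suc w ≤_) (sym k≡) (s≤s (ℕ.m≤n+m w M))
    -- The clique is S₁: its indices are at most w, so any two of them are near.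
    place : Fin (suc w) → Fin k
    place t = fromℕ< (ℕ.<-≤-trans (toℕ<n t) w<k)
    toℕ-place : ∀ t → toℕ (place t) ≡ toℕ t
    toℕ-place t = toℕ-fromℕ< _
    place-injective : ∀ {t t′} → place t ≡ place t′ → t ≡ t′
    place-injective {t} {t′} eq = toℕ-injective (trans (sym (toℕ-place t)) (trans (cong toℕ eq) (toℕ-place t′)))
    place≤ : ∀ t t′ → toℕ (place t) ≤ toℕ (place t′) + w
    place≤ t t′ = ℕ.≤-trans (subst (_≤ w) (sym (toℕ-place t)) (ℕ.s≤s⁻¹ (toℕ<n t))) (ℕ.m≤n+m w _)
    adjacent : ∀ {t t′} → t ≢ t′ → LabelAdj (label (vertex (place t))) (label (vertex (place t′)))
    adjacent {t} {t′} t≢t′ = subst₂ LabelAdj (sym (label-vertex _)) (sym (label-vertex _))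
      (t≢t′ ∘ place-injective , near⇒window (place≤ t′ t , place≤ t t′))

  -- Treewidth: the tree

  Parent : Rel Label 0ℓ
  Parent (inj₁ j)       (inj₁ j′) = toℕ j ≡ suc (toℕ j′)
  Parent (inj₂ (i , _)) (inj₁ j)  = toℕ i ≡ toℕ j
  Parent _              (inj₂ _)  = ⊥

  parent? : B.Decidable Parent
  parent? (inj₁ j)       (inj₁ j′) = toℕ j ℕ.≟ suc (toℕ j′)
  parent? (inj₂ (i , _)) (inj₁ j)  = toℕ i ℕ.≟ toℕ j
  parent? (inj₁ _)       (inj₂ _)  = no λ ()
  parent? (inj₂ _)       (inj₂ _)  = no λ ()

  -- Only strict decrease towards the root matters, so every v_X gets the value `k`, above all
  -- indices of S, instead of its distance to the root.
  depth : Label → ℕ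
  depth (inj₁ j) = toℕ j
  depth (inj₂ _) = k

  parent-unique : ∀ {a b c} → Parent a b → Parent a c → b ≡ c
  parent-unique {inj₁ _} {inj₁ _} {inj₁ _} p q = cong inj₁ (toℕ-injective (ℕ.suc-injective (trans (sym p) q)))
  parent-unique {inj₂ _} {inj₁ _} {inj₁ _} p q = cong inj₁ (toℕ-injective (trans (sym p) q))

  parent-descends : ∀ {a b} → Parent a b → depth b < depth a
  parent-descends {inj₁ _} {inj₁ _} p  = ℕ.≤-reflexive (sym p)
  parent-descends {inj₂ _} {inj₁ j′} _ = toℕ<n j′

  tree : Graph (length vertices)
  tree = record
    { Adj    = λ u v → Parent (label u) (label v) ⊎ Parent (label v) (label u)
    ; adj?   = λ u v → parent? (label u) (label v) ⊎-dec parent? (label v) (label u)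
    ; symm   = Sum.swap
    ; irrefl = λ {u} → [ no-loop (label u) , no-loop (label u) ]′
    }
    where
    no-loop : ∀ l → ¬ Parent l l
    no-loop l = ℕ.<-irrefl refl ∘ parent-descends {l}

  -- The relation that `ConnectedOn` uses; with `P` constantly true it also serves for the
  -- connectedness of the whole tree.
  TreeStep : Pred V 0ℓ → Rel V 0ℓ
  TreeStep P a b = Graph.Adj tree a b × P a × P b

  treeStep-sym : ∀ {P : Pred V 0ℓ} {a b} → TreeStep P a b → TreeStep P b a
  treeStep-sym (adj , p , q) = Sum.swap adj , q , p

  parentStep : ∀ {P : Pred V 0ℓ} u {l j} → label u ≡ l → Parent l (inj₁ j) →
               P u → P (vertex j) → TreeStep P u (vertex j)
  parentStep u {j = j} eq par p q = inj₁ (subst₂ Parent (sym eq) (sym (label-vertex j)) par) , p , q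

  spine : ∀ {P : Pred V 0ℓ} d {j l : Fin k} → toℕ l ≡ d + toℕ j →
          (∀ x → toℕ j ≤ toℕ x → toℕ x ≤ toℕ l → P (vertex x)) → Star (TreeStep P) (vertex l) (vertex j)
  spine zero    eq _ = subst (λ x → Star _ (vertex x) _) (toℕ-injective (sym eq)) ε
  spine {P} (suc d) {j} {l} eq P-on =
    parentStep {P = P} (vertex l) (label-vertex l) (trans eq (cong suc (sym l′≡)))
      (P-on l (subst (toℕ j ≤_) (sym eq) (ℕ.m≤n+m _ (suc d))) ℕ.≤-refl)
      (P-on l′ (subst (toℕ j ≤_) (sym l′≡) (ℕ.m≤n+m _ d)) l′≤l)
    ◅ spine d l′≡ (λ x j≤x x≤l′ → P-on x j≤x (ℕ.≤-trans x≤l′ l′≤l))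
    where
    l′<k : d + toℕ j < k
    l′<k = ℕ.<-trans (ℕ.≤-reflexive (sym eq)) (toℕ<n l)
    l′ = fromℕ< l′<k
    l′≡ : toℕ l′ ≡ d + toℕ j
    l′≡ = toℕ-fromℕ< l′<k
    l′≤l : toℕ l′ ≤ toℕ l
    l′≤l = ℕ.<⇒≤ (ℕ.≤-reflexive (trans (cong suc l′≡) (sym eq)))

  spine-≤ : ∀ {P : Pred V 0ℓ} {j l : Fin k} → toℕ j ≤ toℕ l →
            (∀ x → toℕ j ≤ toℕ x → toℕ x ≤ toℕ l → P (vertex x)) → Star (TreeStep P) (vertex l) (vertex j)
  spine-≤ j≤l = spine _ (sym (ℕ.m∸n+n≡m j≤l))

  -- The first element of `Window i`, from which every v_X of that index hangs in the tree.
  base : Fin (k ∸ w) → Fin k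
  base i = fromℕ< (ℕ.<-≤-trans (toℕ<n i) (ℕ.m∸n≤m k w))

  toℕ-base : ∀ i → toℕ (base i) ≡ toℕ i
  toℕ-base i = toℕ-fromℕ< _

  tree-isTree : IsTree tree
  tree-isTree = record
    { nonEmpty  = nonEmpty (vertex root)
    ; connected = λ u v → Star.map proj₁ (toRoot u ◅◅ reverse treeStep-sym (toRoot v))
    ; acyclic   = acyclic-if-rooted tree (λ u v → Parent (label u) (label v)) (depth ∘ label) id
                    (λ {a} p q → label-injective (parent-unique {label a} p q))
                    (λ {a} → parent-descends {label a})
    }
    where
    nonEmpty : ∀ {n} → Fin n → ℕ.NonZero n
    nonEmpty zero    = _
    nonEmpty (suc _) = _
    root : Fin k
    root = subst Fin (sym k≡) zero
    toℕ-root : toℕ root ≡ 0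
    toℕ-root = toℕ-subst k≡
      where
      toℕ-subst : ∀ {m n} (eq : m ≡ suc n) → toℕ (subst Fin (sym eq) zero) ≡ 0
      toℕ-subst refl = refl
    root≤ : ∀ j → toℕ root ≤ toℕ j
    root≤ j = subst (_≤ toℕ j) (sym toℕ-root) z≤n
    toRoot : ∀ u → Star (TreeStep (λ _ → ⊤)) u (vertex root)
    toRoot u with label u in eq
    ... | inj₁ j = subst (λ x → Star _ x _) (sym (label≡inj₁ eq)) (spine-≤ (root≤ j) _)
    ... | inj₂ (i , X) = parentStep u eq (sym (toℕ-base i)) tt tt ◅ spine-≤ (root≤ (base i)) _

  -- Treewidth: the bags

  Below : Rel Label 0ℓ
  Below (inj₁ j)       (inj₁ l) = toℕ j ≤ toℕ l × toℕ l ≤ toℕ j + w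
  Below (inj₂ (_ , X)) (inj₁ l) = l ∈ X
  Below _              (inj₂ _) = ⊥

  below? : B.Decidable Below
  below? (inj₁ j)       (inj₁ l) = (toℕ j ≤? toℕ l) ×-dec (toℕ l ≤? toℕ j + w)
  below? (inj₂ (_ , X)) (inj₁ l) = l ∈? X
  below? (inj₁ _)       (inj₂ _) = no λ ()
  below? (inj₂ _)       (inj₂ _) = no λ ()

  -- The disjunct `t ≡ u` is what puts v_X into its own bag, the only one that contains it.
  InBag : Rel V 0ℓ
  InBag t u = t ≡ u ⊎ Below (label t) (label u)

  inBag? : ∀ t → Decidable (InBag t)
  inBag? t u = (t ≟ u) ⊎-dec below? (label t) (label u)

  bag : V → Subset (length vertices)
  bag t = ⟦ inBag? t ⟧

  -- An edge inside S is covered by the bag of its endpoint of smaller index, an edge at v_X by the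
  -- bag of v_X.
  bag-edge : ∀ {u v} → LabelAdj (label u) (label v) → ∃[ t ] InBag t u × InBag t v
  bag-edge {u} {v} adj with label u in eq | label v in eq′
  bag-edge {u} {v} (_ , i , j∈ , j′∈) | inj₁ j | inj₁ j′
    with j′≤ , j≤ ← window⇒near i j∈ j′∈ | ℕ.≤-total (toℕ j) (toℕ j′)
  ... | inj₁ j≤j′ = u , inj₁ refl , inj₂ (subst (λ l → Below l (inj₁ j′)) (sym eq) (j≤j′ , j′≤))
  ... | inj₂ j′≤j = v , inj₂ (subst (λ l → Below l (inj₁ j)) (sym eq′) (j′≤j , j≤)) , inj₁ refl
  bag-edge {u} {v} adj | inj₁ j | inj₂ _ = v , inj₂ (subst (λ l → Below l (inj₁ j)) (sym eq′) adj) , inj₁ refl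
  bag-edge {u} {v} adj | inj₂ _ | inj₁ j = u , inj₁ refl , inj₂ (subst (λ l → Below l (inj₁ j)) (sym eq) adj)

  BagsOf : V → Pred V 0ℓ
  BagsOf v t = v ∈ bag t

  vertex∈BagsOf : ∀ {v l x} → label v ≡ inj₁ l → toℕ x ≤ toℕ l → toℕ l ≤ toℕ x + w → BagsOf v (vertex x)
  vertex∈BagsOf {x = x} eq p q = ∈⟦⟧⁺ (inBag? (vertex x)) (inj₂ (subst₂ Below (sym (label-vertex x)) (sym eq) (p , q)))

  -- Each x between j and l satisfies x ≤ l ≤ j + w ≤ x + w, so its bag contains s_l too.
  spine-toHub : ∀ {v l j} → label v ≡ inj₁ l → toℕ j ≤ toℕ l → toℕ l ≤ toℕ j + w →
                Star (TreeStep (BagsOf v)) (vertex j) v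
  spine-toHub {v} {j = j} eq j≤l l≤j+w = subst (Star (TreeStep (BagsOf v)) (vertex j)) (sym (label≡inj₁ eq))
    (reverse treeStep-sym (spine-≤ j≤l (λ x j≤x x≤l →
      vertex∈BagsOf eq x≤l (ℕ.≤-trans l≤j+w (ℕ.+-monoˡ-≤ w j≤x)))))

  -- From the bag of v_X the walk first goes to the parent, whose bag carries the whole window and
  -- therefore every element of X, and then along the spine.
  below-toHub : ∀ {v t} l l′ → label t ≡ l → label v ≡ l′ → Below l l′ → BagsOf v t → Star (TreeStep (BagsOf v)) t v
  below-toHub {v} (inj₁ j) (inj₁ l) eq eq′ (j≤l , l≤j+w) _ =
    subst (λ x → Star (TreeStep (BagsOf v)) x v) (sym (label≡inj₁ eq)) (spine-toHub eq′ j≤l l≤j+w)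
  below-toHub {v} {t} (inj₂ (i , X)) (inj₁ l) eq eq′ l∈X v∈ =
    parentStep {P = BagsOf v} t eq (sym (toℕ-base i)) v∈ (vertex∈BagsOf eq′ base≤l l≤base+w)
    ◅ spine-toHub eq′ base≤l l≤base+w
    where
    l∈W : l ∈ Window i
    l∈W = proj₁ (proj₁ (admissible t eq)) l∈X
    base≤l : toℕ (base i) ≤ toℕ l
    base≤l = subst (_≤ toℕ l) (sym (toℕ-base i)) (proj₁ (∈Window⁻ {i} l∈W))
    l≤base+w : toℕ l ≤ toℕ (base i) + w
    l≤base+w = subst (λ x → toℕ l ≤ x + w) (sym (toℕ-base i)) (proj₂ (∈Window⁻ {i} l∈W))

  -- Coherence is proved by joining every node whose bag contains `v` to the node `v` itself.
  bag-toHub : ∀ v t → BagsOf v t → Star (TreeStep (BagsOf v)) t v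
  bag-toHub v t v∈ with ∈⟦⟧⁻ (inBag? t) v∈
  ... | inj₁ refl  = ε
  ... | inj₂ below = below-toHub (label t) (label v) refl refl below v∈

  decomposition : TreeDecomposition graph
  decomposition = record
    { tree      = tree
    ; isTree    = tree-isTree
    ; bag       = bag
    ; vertex-in = λ v → v , ∈⟦⟧⁺ (inBag? v) (inj₁ refl)
    ; edge-in   = λ {u} {v} adj → let t , p , q = bag-edge {u} {v} adj in
                                  t , ∈⟦⟧⁺ (inBag? t) p , ∈⟦⟧⁺ (inBag? t) q
    ; coherent  = λ v {t} {t′} p q → bag-toHub v t p ◅◅ reverse treeStep-sym (bag-toHub v t′ q)
    }

  ∈bag⁻ : ∀ t {l u} → label t ≡ l → u ∈ bag t → t ≡ u ⊎ ∃[ j ] label u ≡ inj₁ j × Below l (inj₁ j)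
  ∈bag⁻ t {u = u} refl u∈ with ∈⟦⟧⁻ (inBag? t) u∈
  ... | inj₁ t≡u = inj₁ t≡u
  ... | inj₂ below with label t | label u
  ...   | inj₁ _ | inj₁ j = inj₂ (j , refl , below)
  ...   | inj₂ _ | inj₁ j = inj₂ (j , refl , below)

  -- `position` maps the bag injectively into w + 1 consecutive integers: those from j on for s_j,
  -- those of the window for v_X.
  ∣bag∣≤ : ∀ t l → label t ≡ l → ∣ bag t ∣ ≤ suc w
  ∣bag∣≤ t (inj₁ j) eq = interval-injection⇒∣p∣≤ (toℕ j) (position 0 ∘ label) bounded
      (λ u∈ v∈ → equal-positions (proj₁ (proj₂ (on-spine u∈))) (proj₁ (proj₂ (on-spine v∈))))
    where
    on-spine : ∀ {u} → u ∈ bag t → ∃[ l ] label u ≡ inj₁ l × toℕ j ≤ toℕ l × toℕ l ≤ toℕ j + w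
    on-spine u∈ with ∈bag⁻ t eq u∈
    ... | inj₁ refl  = j , eq , ℕ.≤-refl , ℕ.m≤m+n _ w
    ... | inj₂ found = found
    bounded : ∀ {u} → u ∈ bag t → toℕ j ≤ position 0 (label u) × position 0 (label u) ≤ toℕ j + w
    bounded u∈ with l , u≡ , range ← on-spine u∈ =
      subst (λ x → toℕ j ≤ x × x ≤ toℕ j + w) (sym (cong (position 0) u≡)) range
  -- v_X is given the position of an element y of its window missing from X.
  ∣bag∣≤ t (inj₂ (i , X)) eq with (X⊆W , y , y∈W , y∉X) , _ ← admissible t eq =
    interval-injection⇒∣p∣≤ (toℕ i) (pos ∘ label) bounded injective
    where
    pos : Label → ℕ
    pos = position (toℕ y)
    own-position : pos (label t) ≡ toℕ y
    own-position = cong pos eq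
    bounded : ∀ {u} → u ∈ bag t → toℕ i ≤ pos (label u) × pos (label u) ≤ toℕ i + w
    bounded u∈ with ∈bag⁻ t eq u∈
    ... | inj₁ refl = subst (λ x → toℕ i ≤ x × x ≤ toℕ i + w) (sym own-position) (∈Window⁻ {i} y∈W)
    ... | inj₂ (l , u≡ , l∈X) =
      subst (λ x → toℕ i ≤ x × x ≤ toℕ i + w) (sym (cong pos u≡)) (∈Window⁻ {i} (X⊆W l∈X))
    own≢ : ∀ {u l} → label u ≡ inj₁ l → l ∈ X → pos (label t) ≢ pos (label u)
    own≢ u≡ l∈X eq′ = y∉X (subst (_∈ X)
      (toℕ-injective (sym (trans (sym own-position) (trans eq′ (cong pos u≡))))) l∈X)
    injective : ∀ {u v} → u ∈ bag t → v ∈ bag t → pos (label u) ≡ pos (label v) → u ≡ v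
    injective u∈ v∈ eq′ with ∈bag⁻ t eq u∈ | ∈bag⁻ t eq v∈
    ... | inj₁ refl           | inj₁ refl           = refl
    ... | inj₁ refl           | inj₂ (_ , v≡ , l∈X) = ⊥-elim (own≢ v≡ l∈X eq′)
    ... | inj₂ (_ , u≡ , l∈X) | inj₁ refl           = ⊥-elim (own≢ u≡ l∈X (sym eq′))
    ... | inj₂ (_ , u≡ , _)   | inj₂ (_ , v≡ , _)   = equal-positions u≡ v≡ eq′

  treewidth : IsTreewidth graph w
  treewidth =
    (decomposition , ℕ.≤-antisym (width≤ decomposition (λ t → ∣bag∣≤ t (label t) refl)) (clique-width decomposition)) ,
    clique-width

theorem7 : (w k : ℕ) → 2 * w + 1 ≤ k → 3 ≤ 2 * w + 1 →
    IsTreewidth G[ w , k ] w ×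
    ncMax G[ w , k ] k ≡ nc G[ w , k ] S[ w , k ] ×
    nc G[ w , k ] S[ w , k ] ≡ order G[ w , k ] ×
    order G[ w , k ] ≡ (k ∸ w + 1) * 2 ^ w + w
theorem7 w k 2w+1≤k _ =
  treewidth w k M k≡ ,
  nc≡order⇒ncMax≡nc G[ w , k ] S[ w , k ] (nc-distinguished w k M k≡ w≤M) (∣distinguished∣≡ w k M k≡) ,
  nc-distinguished w k M k≡ w≤M , order-formula w k M k≡
  where
  -- The index of the last window, counting from 0.
  M = k ∸ suc w
  2w+1≡ : 2 * w + 1 ≡ w + suc w
  2w+1≡ = solve 1 (λ w → con 2 :* w :+ con 1 := w :+ (con 1 :+ w)) refl w
    where open +-*-Solver
  w+1+w≤k : w + suc w ≤ k
  w+1+w≤k = subst (_≤ k) 2w+1≡ 2w+1≤k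
  w≤M : w ≤ M
  w≤M = ℕ.m+n≤o⇒m≤o∸n w w+1+w≤k
  k≡ : k ≡ suc M + w
  k≡ = trans (sym (ℕ.m∸n+n≡m (ℕ.m+n≤o⇒n≤o w w+1+w≤k))) (ℕ.+-suc M w)
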